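{- Let $x$ be a finite nonempty word over the alphabet $\{0,1\}$. Then $x$ is mesosome-free if and only if $x$ or its binary complement $\overline{x}$ has one of the following forms: (a) $0^{i}$ for some integer $i \geq 1$; (b) $0^{i}1^{j}$ for some integers $i, j \geq 1$; (c) $0^{i}1^{j}0^{k}$ for some integers $i, j, k \geq 1$ with $j$ odd; (d) $0^{i}101^{j}$ for some integers $i, j \geq 1$; (e) $0^{i}1^{j}0^{k}1^{\ell}$ for some integers $i, j, k, \ell \geq 1$ with $j$ and $k$ odd, $i<k$ and $j>\ell$; (f) $(01)^{i}$ or $(01)^{i}0$ for some integer $i \geq 1$.
   Context: Two finite words $x, x'$ are conjugates if there exist (possibly empty) words $u, v$ with $x = uv$ and $x' = vu$. A finite nonempty word $w$ is a mesosome if it is of the form $w = xx'$ where $x'$ is a conjugate of $x$ and $x \neq x'$. A factor of a word is a contiguous sub-block of it. A word is mesosome-free (avoids mesosomes) if none of its factors is a mesosome. The binary complement $\overline{x}$ of a word $x$ over $\{0,1\}$ is obtained by replacing each $0$ by $1$ and each $1$ by $0$. -}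

module Defs where

open import Data.Bool.Base using (Bool; true; false; not)
open import Data.List.Base using (List; []; _∷_; _++_; concat; map; replicate)
open import Data.List.Relation.Binary.Infix.Heterogeneous using (Infix)
open import Data.Nat.Base using (ℕ; _≥_; _<_; _>_; parity)
open import Data.Parity.Base using (1ℙ)
open import Data.Product.Base using (_×_; ∃₂)
open import Relation.Binary.PropositionalEquality.Core using (_≡_; _≢_)
open import Relation.Nullary.Negation.Core using (¬_)

module _ {a} {A : Set a} where

  Conjugate : List A → List A → Set a
  Conjugate x x′ = ∃₂ λ u v → x ≡ u ++ v × x′ ≡ v ++ u

  Mesosome : List A → Set a
  Mesosome w = w ≢ [] × ∃₂ λ x x′ → w ≡ x ++ x′ × Conjugate x x′ × x ≢ x′

  Factor : List A → List A → Set a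
  Factor = Infix _≡_

  MesosomeFree : List A → Set a
  MesosomeFree w = ∀ {f} → Factor f w → ¬ Mesosome f

  infixr 8 _^_

  _^_ : List A → ℕ → List A
  w ^ n = concat (replicate n w)

-- The letter 0 is false and the letter 1 is true.
BinaryWord : Set
BinaryWord = List Bool

𝟎 𝟏 : BinaryWord
𝟎 = false ∷ []
𝟏 = true ∷ []

complement : BinaryWord → BinaryWord
complement = map not

Odd : ℕ → Set
Odd n = parity n ≡ 1ℙ

data Form : BinaryWord → Set where
  form-a  : ∀ {i} → i ≥ 1 →
            Form (𝟎 ^ i)
  form-b  : ∀ {i j} → i ≥ 1 → j ≥ 1 →
            Form (𝟎 ^ i ++ 𝟏 ^ j)
  form-c  : ∀ {i j k} → i ≥ 1 → j ≥ 1 → k ≥ 1 → Odd j →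
            Form (𝟎 ^ i ++ 𝟏 ^ j ++ 𝟎 ^ k)
  form-d  : ∀ {i j} → i ≥ 1 → j ≥ 1 →
            Form (𝟎 ^ i ++ 𝟏 ++ 𝟎 ++ 𝟏 ^ j)
  form-e  : ∀ {i j k ℓ} → i ≥ 1 → j ≥ 1 → k ≥ 1 → ℓ ≥ 1 →
            Odd j → Odd k → i < k → j > ℓ →
            Form (𝟎 ^ i ++ 𝟏 ^ j ++ 𝟎 ^ k ++ 𝟏 ^ ℓ)
  form-f₁ : ∀ {i} → i ≥ 1 →
            Form ((𝟎 ++ 𝟏) ^ i)
  form-f₂ : ∀ {i} → i ≥ 1 →
            Form ((𝟎 ++ 𝟏) ^ i ++ 𝟎)

{-# OPTIONS --safe #-}
module Submission where

-- If w is mesosome-free then so is its tail, so it suffices to prepend one letter to each form: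
-- the result is again a form (up to complement), or it has a prefix uvvu with uv ≠ vu.
-- Up to complement the prefixes that occur are
--   1 0²ᵐ 1,   1 0ⁱ 1²ᵈ⁺¹ 0ⁱ,   0ᵏ 1²ᵈ⁺¹ 0ᵏ 1   (m, d, i, k ≥ 1)   and   101011.
-- Conversely, tails of forms are empty or again forms (up to complement), so only prefixes xx′ of a
-- form have to be examined.  Comparing the numbers of 0s and 1s in x and x′ already forces x = x′.

open import Defs
open import Data.Bool.Base using (Bool; true; false; not)
open import Data.Bool.Properties using (_≟_; not-involutive; not-injective)
open import Data.Empty using (⊥; ⊥-elim)
open import Data.List.Base using ([]; _∷_; [_]; _++_; length; filter; drop)
open import Data.List.Properties
  using (∷-injective; ++-assoc; ++-identityʳ; ++-conical; ++-conicalˡ; map-++; map-∘; map-cong; map-id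
        ; map-injective; filter-++; length-++)
open import Data.List.Relation.Binary.Infix.Heterogeneous using (here; there)
import Data.List.Relation.Binary.Infix.Heterogeneous as Infix
import Data.List.Relation.Binary.Infix.Heterogeneous.Properties as Infix
open import Data.List.Relation.Binary.Pointwise using (≡⇒Pointwise-≡; Pointwise-≡⇒≡)
open import Data.List.Relation.Binary.Prefix.Heterogeneous as Prefix using (Prefix)
open import Data.Nat.Base using (ℕ; zero; suc; _+_; _≤_; _≥_; _<_; z≤n; s≤s; parity)
open import Data.Nat.Properties
  using (+-comm; +-suc; +-identityʳ; suc-injective; m≢1+n+m; m≤m+n; m≤n+m; n≤0⇒n≡0; ≤-antisym
        ; <⇒≤; <⇒≱; ≤⇒≯; ≮⇒≥; _<?_; m≤n⇒∃[o]m+o≡n; module ≤-Reasoning)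
open import Data.Parity.Properties using (+-homo-+; p+p≡0ℙ)
open import Data.Product.Base using (∃; ∃₂; _×_; _,_; proj₁; proj₂)
open import Data.Sum.Base using (_⊎_; inj₁; inj₂)
open import Function.Base using (_∘_)
open import Function.Bundles using (_⇔_; mk⇔)
open import Relation.Binary.PropositionalEquality
  using (_≡_; _≢_; refl; sym; trans; cong; cong₂; subst; subst₂; module ≡-Reasoning)
open import Relation.Nullary using (¬_; yes; no; contradiction)

private variable
  a b c : Bool
  m n : ℕ
  w x x′ y : BinaryWord

-- Complementation and powers.

Good : BinaryWord → Set
Good w = Form w ⊎ Form (complement w)

complement-involutive : ∀ w → complement (complement w) ≡ w
complement-involutive w = trans (sym (map-∘ w)) (trans (map-cong not-involutive w) (map-id w))

-- The trailing word `t` matches the right-nested products of blocks in `Form`, so a block can be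
-- rewritten in place.
complement-^-++ : ∀ w n t → complement (w ^ n ++ t) ≡ complement w ^ n ++ complement t
complement-^-++ w zero    t = refl
complement-^-++ w (suc n) t = begin
  complement ((w ++ w ^ n) ++ t)                    ≡⟨ cong complement (++-assoc w (w ^ n) t) ⟩
  complement (w ++ w ^ n ++ t)                      ≡⟨ map-++ not w (w ^ n ++ t) ⟩
  complement w ++ complement (w ^ n ++ t)           ≡⟨ cong (complement w ++_) (complement-^-++ w n t) ⟩
  complement w ++ complement w ^ n ++ complement t  ≡⟨ ++-assoc (complement w) _ _ ⟨
  complement w ^ suc n ++ complement t              ∎
  where open ≡-Reasoning

complement-^ : ∀ w n → complement (w ^ n) ≡ complement w ^ n
complement-^ w n = begin
  complement (w ^ n)        ≡⟨ cong complement (++-identityʳ (w ^ n)) ⟨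
  complement (w ^ n ++ [])  ≡⟨ complement-^-++ w n [] ⟩
  complement w ^ n ++ []    ≡⟨ ++-identityʳ _ ⟩
  complement w ^ n          ∎
  where open ≡-Reasoning

^-+-++ : ∀ (w : BinaryWord) m n t → w ^ (m + n) ++ t ≡ w ^ m ++ w ^ n ++ t
^-+-++ w zero    n t = refl
^-+-++ w (suc m) n t = begin
  (w ++ w ^ (m + n)) ++ t      ≡⟨ ++-assoc w _ t ⟩
  w ++ w ^ (m + n) ++ t        ≡⟨ cong (w ++_) (^-+-++ w m n t) ⟩
  w ++ w ^ m ++ w ^ n ++ t     ≡⟨ ++-assoc w _ _ ⟨
  (w ++ w ^ m) ++ w ^ n ++ t   ∎
  where open ≡-Reasoning

complement₂ : ∀ u i v j → complement (u ^ i ++ v ^ j) ≡ complement u ^ i ++ complement v ^ j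
complement₂ u i v j = trans (complement-^-++ u i _) (cong (complement u ^ i ++_) (complement-^ v j))

complement₃ : ∀ u i v j w k →
  complement (u ^ i ++ v ^ j ++ w ^ k) ≡ complement u ^ i ++ complement v ^ j ++ complement w ^ k
complement₃ u i v j w k =
  trans (complement-^-++ u i _) (cong (complement u ^ i ++_) (complement₂ v j w k))

-- (ab)ⁿa = a(ba)ⁿ
shift : ∀ (a b : Bool) n t → [ a ] ++ (b ∷ a ∷ []) ^ n ++ t ≡ (a ∷ b ∷ []) ^ n ++ a ∷ t
shift a b zero    t = refl
shift a b (suc n) t = cong (λ u → a ∷ b ∷ u) (shift a b n t)

Conjugate-complement : Conjugate x x′ → Conjugate (complement x) (complement x′)
Conjugate-complement (u , v , refl , refl) = complement u , complement v , map-++ not u v , map-++ not v u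

Mesosome-complement : Mesosome w → Mesosome (complement w)
Mesosome-complement {[]} (w≢[] , _) = contradiction refl w≢[]
Mesosome-complement {_ ∷ _} (w≢[] , x , x′ , w≡ , conj , x≢x′) =
  (λ ()) , complement x , complement x′ , trans (cong complement w≡) (map-++ not x x′)
  , Conjugate-complement conj , x≢x′ ∘ map-injective not-injective

Factor-complement : Factor x w → Factor (complement x) (complement w)
Factor-complement = Infix.map⁺ not not ∘ Infix.map (cong not)

MesosomeFree-complement : MesosomeFree w → MesosomeFree (complement w)
MesosomeFree-complement {w} free f∈w =
  free (subst (Factor _) (complement-involutive w) (Factor-complement f∈w)) ∘ Mesosome-complement

MesosomeFree-resp : w ≡ y → MesosomeFree w → MesosomeFree y
MesosomeFree-resp refl free = free

MesosomeFree-tail : MesosomeFree (c ∷ w) → MesosomeFree w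
MesosomeFree-tail free f∈w = free (there f∈w)

-- Parity and halving.

parity-m+m : ∀ m → ¬ Odd (m + m)
parity-m+m m odd with () ← trans (sym odd) (trans (+-homo-+ m m) (p+p≡0ℙ (parity m)))

odd-suc-m+m : ∀ m → Odd (suc (m + m))
odd-suc-m+m zero    = refl
odd-suc-m+m (suc m) rewrite +-suc m m = odd-suc-m+m m

halve : ∀ n → ∃ λ m → n ≡ m + m ⊎ n ≡ suc (m + m)
halve zero = 0 , inj₁ refl
halve (suc n) with halve n
... | m , inj₁ refl = m , inj₂ refl
... | m , inj₂ refl = suc m , inj₁ (cong suc (sym (+-suc m m)))

halve-odd : Odd n → ∃ λ m → n ≡ suc (m + m)
halve-odd {n} odd with halve n
... | m , inj₁ refl = contradiction odd (parity-m+m m)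
... | m , inj₂ eq   = m , eq

-- Words with a mesosome as prefix.

-- The prefix uvvu is xx′ with x = uv and its conjugate x′ = vu.
conjugate-prefix : ∀ u v s → u ++ v ≢ v ++ u → w ≡ u ++ v ++ v ++ u ++ s → ¬ MesosomeFree w
conjugate-prefix u v s uv≢vu refl free =
  free (Infix.fromView (subst (Infix.View _≡_ uvvu) reassoc
         (Infix.MkView [] (≡⇒Pointwise-≡ refl) s)))
       (nonempty , u ++ v , v ++ u , refl , (u , v , refl , refl) , uv≢vu)
  where
  uvvu : BinaryWord
  uvvu = (u ++ v) ++ v ++ u
  reassoc : uvvu ++ s ≡ u ++ v ++ v ++ u ++ s
  reassoc = trans (++-assoc (u ++ v) (v ++ u) s)
           (trans (++-assoc u v _) (cong (λ t → u ++ v ++ t) (++-assoc v u s)))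
  nonempty : uvvu ≢ []
  nonempty eq with uv≡[] , vu≡[] ← proj₁ ++-conical (u ++ v) (v ++ u) eq , proj₂ ++-conical (u ++ v) (v ++ u) eq
    = uv≢vu (trans uv≡[] (sym vu≡[]))

-- Halving the block of zeros gives u = 1 and v = 0ᵐ.
even-block : ∀ m s → m + m ≥ 1 → ¬ MesosomeFree (true ∷ 𝟎 ^ (m + m) ++ true ∷ s)
even-block (suc m) s _ =
  conjugate-prefix 𝟏 (𝟎 ^ suc m) s (λ ()) (cong (true ∷_) (^-+-++ 𝟎 (suc m) (suc m) (true ∷ s)))

-- Take u = 1 0^(i+1) and v = 1^(d+1): the odd block of ones is v, v and the first letter of the
-- second u. The words uv and vu differ at their second letter.
equal-outer-blocks : ∀ i d s →
  ¬ MesosomeFree (true ∷ 𝟎 ^ suc i ++ 𝟏 ^ suc (suc d + suc d) ++ 𝟎 ^ suc i ++ s)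
equal-outer-blocks i d s = conjugate-prefix (𝟏 ++ 𝟎 ^ suc i) (𝟏 ^ suc d) s (neq d) (cong (true ∷_) eq)
  where
  neq : ∀ d → (𝟏 ++ 𝟎 ^ suc i) ++ 𝟏 ^ suc d ≢ 𝟏 ^ suc d ++ 𝟏 ++ 𝟎 ^ suc i
  neq zero    ()
  neq (suc _) ()
  eq : 𝟎 ^ suc i ++ 𝟏 ^ suc (suc d + suc d) ++ 𝟎 ^ suc i ++ s ≡
       𝟎 ^ suc i ++ 𝟏 ^ suc d ++ 𝟏 ^ suc d ++ (𝟏 ++ 𝟎 ^ suc i) ++ s
  eq = cong (𝟎 ^ suc i ++_) (trans (cong (λ n → 𝟏 ^ n ++ 𝟎 ^ suc i ++ s) (regroup d))
     (trans (^-+-++ 𝟏 (suc d) (suc d + 1) _) (cong (𝟏 ^ suc d ++_) (^-+-++ 𝟏 (suc d) 1 _))))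
    where
    regroup : ∀ d → suc (suc d + suc d) ≡ suc d + (suc d + 1)
    regroup d = trans (sym (+-suc (suc d) (suc d))) (cong (λ n → suc d + suc n) (+-comm 1 d))

-- Take u = a^(k+1) b and v = b^(d+1): the first b of the odd block ends the first u, and the even
-- rest is vv. The words uv and vu differ at their first letter.
short-last-block : ∀ k d s → a ≢ b →
  ¬ MesosomeFree ([ a ] ^ suc k ++ [ b ] ^ suc (suc d + suc d) ++ [ a ] ^ suc k ++ b ∷ s)
short-last-block {a} {b} k d s a≢b =
  conjugate-prefix ([ a ] ^ suc k ++ [ b ]) ([ b ] ^ suc d) s (a≢b ∘ proj₁ ∘ ∷-injective) eq
  where
  A B : BinaryWord
  A = [ a ] ^ suc k
  B = [ b ] ^ suc d
  eq : A ++ [ b ] ++ [ b ] ^ (suc d + suc d) ++ A ++ [ b ] ++ s ≡ (A ++ [ b ]) ++ B ++ B ++ (A ++ [ b ]) ++ s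
  eq = begin
    A ++ [ b ] ++ [ b ] ^ (suc d + suc d) ++ A ++ [ b ] ++ s
      ≡⟨ cong (λ u → A ++ [ b ] ++ u) (^-+-++ [ b ] (suc d) (suc d) _) ⟩
    A ++ [ b ] ++ B ++ B ++ A ++ [ b ] ++ s
      ≡⟨ ++-assoc A [ b ] _ ⟨
    (A ++ [ b ]) ++ B ++ B ++ A ++ [ b ] ++ s
      ≡⟨ cong (λ u → (A ++ [ b ]) ++ B ++ B ++ u) (++-assoc A [ b ] s) ⟨
    (A ++ [ b ]) ++ B ++ B ++ (A ++ [ b ]) ++ s ∎
    where open ≡-Reasoning

power-prefix : ∀ (c : Bool) t → m ≤ n → ∃ λ s → [ c ] ^ n ++ t ≡ [ c ] ^ m ++ s
power-prefix {m} c t m≤n with o , refl ← m≤n⇒∃[o]m+o≡n m≤n = [ c ] ^ o ++ t , ^-+-++ [ c ] m o t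

-- Prepending a letter to a form.

complement-01ⁿ : ∀ n → (𝟎 ++ 𝟏) ^ n ++ 𝟎 ≡ complement (true ∷ (𝟎 ++ 𝟏) ^ n)
complement-01ⁿ n = begin
  (𝟎 ++ 𝟏) ^ n ++ 𝟎                ≡⟨ shift false true n [] ⟨
  false ∷ (𝟏 ++ 𝟎) ^ n ++ []       ≡⟨ cong (false ∷_) (++-identityʳ _) ⟩
  false ∷ (𝟏 ++ 𝟎) ^ n             ≡⟨ cong (false ∷_) (complement-^ (𝟎 ++ 𝟏) n) ⟨
  complement (true ∷ (𝟎 ++ 𝟏) ^ n) ∎
  where open ≡-Reasoning

complement-01ⁿ0 : ∀ n → (𝟎 ++ 𝟏) ^ suc n ≡ complement (true ∷ (𝟎 ++ 𝟏) ^ n ++ 𝟎)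
complement-01ⁿ0 n = cong (false ∷_) (begin
  true ∷ (𝟎 ++ 𝟏) ^ n               ≡⟨ ++-identityʳ _ ⟨
  true ∷ (𝟎 ++ 𝟏) ^ n ++ []         ≡⟨ shift true false n [] ⟩
  (𝟏 ++ 𝟎) ^ n ++ 𝟏                 ≡⟨ complement-^-++ (𝟎 ++ 𝟏) n 𝟎 ⟨
  complement ((𝟎 ++ 𝟏) ^ n ++ 𝟎)    ∎)
  where open ≡-Reasoning

-- A leading 1 becomes, in the complement, a new first block consisting of a single 0.
extend-true : complement y ≡ w → Form (false ∷ w) → Good (true ∷ y)
extend-true refl = inj₂

-- In (b) to (e) a new leading 1 encloses the first block of zeros between ones, so `even-block`
-- makes its length odd. A new leading 0 lengthens that block, which is restricted only by i < k in
-- (e).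
extend : ∀ c → Form y → MesosomeFree (c ∷ y) → Good (c ∷ y)
extend false (form-a {i} _) _ = inj₁ (form-a {suc i} (s≤s z≤n))
extend true (form-a {i} i≥1) _ = extend-true (complement-^ 𝟎 i) (form-b {1} (s≤s z≤n) i≥1)

extend false (form-b {i} _ j≥1) _ = inj₁ (form-b {suc i} (s≤s z≤n) j≥1)
extend true (form-b {i} {suc j} i≥1 j≥1) free with halve i
... | m , inj₁ refl = ⊥-elim (even-block m _ i≥1 free)
... | m , inj₂ refl =
  extend-true (complement₂ 𝟎 i 𝟏 (suc j)) (form-c {1} (s≤s z≤n) i≥1 j≥1 (odd-suc-m+m m))

extend false (form-c {i} _ j≥1 k≥1 odd-j) _ = inj₁ (form-c {suc i} (s≤s z≤n) j≥1 k≥1 odd-j)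
extend true (form-c {i} {j} {suc k} i≥1 j≥1 k≥1 odd-j) free with halve i | halve-odd {j} odd-j
... | m     , inj₁ refl | d     , refl = ⊥-elim (even-block m _ i≥1 free)
-- Here i = j = 1, and the complement 0 1 0 1^(k+1) is of form (d).
... | zero  , inj₂ refl | zero  , refl =
  extend-true (cong (λ u → true ∷ false ∷ true ∷ u) (complement-^ 𝟎 k)) (form-d {1} (s≤s z≤n) k≥1)
... | suc m , inj₂ refl | zero  , refl = ⊥-elim (short-last-block 0 m (𝟎 ^ k) (λ ()) free)
-- Now j is at least 3, and the complement 0 1ⁱ 0ʲ 1^(k+1) has form (e) as soon as k+1 < i.
... | m     , inj₂ refl | suc d , refl with suc k <? i
...   | yes k<i = extend-true (complement₃ 𝟎 i 𝟏 j 𝟎 (suc k))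
  (form-e {1} (s≤s z≤n) i≥1 j≥1 k≥1 (odd-suc-m+m m) odd-j (s≤s (s≤s z≤n)) k<i)
-- Otherwise the last block contains i zeros, matching the first block; `m + m` is i less one.
...   | no  k≮i with s , eq ← power-prefix false [] (≮⇒≥ k≮i) =
  ⊥-elim (equal-outer-blocks (m + m) d s (MesosomeFree-resp
    (cong (λ u → true ∷ 𝟎 ^ i ++ 𝟏 ^ j ++ u) (trans (sym (++-identityʳ _)) eq)) free))

extend false (form-d {i} _ j≥1) _ = inj₁ (form-d {suc i} (s≤s z≤n) j≥1)
extend true (form-d {i} {j} i≥1 j≥1) free with halve i | j
... | m     , inj₁ refl | _           = ⊥-elim (even-block m _ i≥1 free)
... | suc m , inj₂ refl | _           = ⊥-elim (short-last-block 0 m _ (λ ()) free)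
... | zero  , inj₂ refl | 1           = inj₂ (form-f₂ {2} (s≤s z≤n))
-- With u = 1 and v = 01, uvvu is 101011.
... | zero  , inj₂ refl | suc (suc _) = ⊥-elim (conjugate-prefix 𝟏 (𝟎 ++ 𝟏) _ (λ ()) refl free)

extend false (form-e {i} {j} {k} {suc ℓ} i≥1 j≥1 k≥1 ℓ≥1 odd-j odd-k i<k ℓ<j) free
  with suc i <? k | halve-odd {j} odd-j
... | yes 1+i<k | _ = inj₁ (form-e {suc i} (s≤s z≤n) j≥1 k≥1 ℓ≥1 odd-j odd-k 1+i<k ℓ<j)
... | no  _     | zero  , refl = contradiction ℓ<j λ { (s≤s ()) }
-- Lengthening the first block violates (e) only if k = i+1; then both blocks of zeros have equal
-- length, and j is at least 3.
... | no  1+i≮k | suc d , refl with refl ← ≤-antisym i<k (≮⇒≥ 1+i≮k) =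
  ⊥-elim (short-last-block i d _ (λ ()) free)
-- No extension survives here: for odd i, the inequality i < k supplies i zeros after the block of
-- ones.
extend true (form-e {i} {j} {k} {suc ℓ} i≥1 j≥1 k≥1 ℓ≥1 odd-j odd-k i<k ℓ<j) free
  with halve i | halve-odd {j} odd-j
... | m , inj₁ refl | d     , refl = ⊥-elim (even-block m _ i≥1 free)
... | m , inj₂ refl | zero  , refl = contradiction ℓ<j λ { (s≤s ()) }
... | m , inj₂ refl | suc d , refl with s , eq ← power-prefix false (𝟏 ^ suc ℓ) (<⇒≤ i<k) =
  ⊥-elim (equal-outer-blocks (m + m) d s (MesosomeFree-resp
    (cong (λ u → true ∷ 𝟎 ^ i ++ 𝟏 ^ j ++ u) eq) free))

extend false (form-f₁ {1} _) _ = inj₁ (form-b {2} {1} (s≤s z≤n) (s≤s z≤n))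
extend false (form-f₁ {2} _) _ = inj₁ (form-d {2} {1} (s≤s z≤n) (s≤s z≤n))
-- With u = 0 and v = 01, uvvu is 001010.
extend false (form-f₁ {suc (suc (suc _))} _) free =
  ⊥-elim (conjugate-prefix 𝟎 (𝟎 ++ 𝟏) _ (λ ()) refl free)
extend true (form-f₁ {i} i≥1) _ = inj₂ (subst Form (complement-01ⁿ i) (form-f₂ i≥1))

extend false (form-f₂ {1} _) _ = inj₁ (form-c {2} {1} {1} (s≤s z≤n) (s≤s z≤n) (s≤s z≤n) refl)
extend false (form-f₂ {2} _) free =
  ⊥-elim (conjugate-prefix 𝟎 (𝟎 ++ 𝟏) _ (λ ()) refl free)
extend false (form-f₂ {suc (suc (suc _))} _) free =
  ⊥-elim (conjugate-prefix 𝟎 (𝟎 ++ 𝟏) _ (λ ()) refl free)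
extend true (form-f₂ {i} _) _ = inj₂ (subst Form (complement-01ⁿ0 i) (form-f₁ {suc i} (s≤s z≤n)))

classify : ∀ w → w ≢ [] → MesosomeFree w → Good w
classify []          w≢[] _ = contradiction refl w≢[]
classify (false ∷ []) _   _ = inj₁ (form-a {1} (s≤s z≤n))
classify (true ∷ [])  _   _ = inj₂ (form-a {1} (s≤s z≤n))
classify (c ∷ y@(_ ∷ _)) _ free with classify y (λ ()) (MesosomeFree-tail free)
... | inj₁ F = extend c F free
-- The complement of `y` has a form, so the complemented letter is prepended to it and the result is
-- complemented back.
... | inj₂ F with extend (not c) F (MesosomeFree-complement free)
...   | inj₁ G = inj₂ G
...   | inj₂ G = inj₁ (subst Form (complement-involutive (c ∷ y)) G)

-- Removing the first letter of a form.

Good-complement : Good w → Good (complement w)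
Good-complement (inj₁ F) = inj₂ (subst Form (sym (complement-involutive _)) F)
Good-complement (inj₂ F) = inj₁ F

-- A first block of length at least 2 only shrinks. If its length is 1, the complement of the tail
-- passes from (b) to (a), from (c) to (b), and from (d) and (e) to (c); the two alternating forms
-- map to each other, except that 01 leaves a single letter. Using `drop 1` avoids unifying the
-- indices of `Form` with a cons.
Form-tail : Form w → drop 1 w ≡ [] ⊎ Good (drop 1 w)
Form-tail (form-a {1} _)           = inj₁ refl
Form-tail (form-a {suc (suc i)} _) = inj₂ (inj₁ (form-a {suc i} (s≤s z≤n)))
Form-tail (form-b {1} {j} _ j≥1)           = inj₂ (inj₂ (subst Form (sym (complement-^ 𝟏 j)) (form-a j≥1)))
Form-tail (form-b {suc (suc i)} _ j≥1) = inj₂ (inj₁ (form-b {suc i} (s≤s z≤n) j≥1))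
Form-tail (form-c {1} {j} {k} _ j≥1 k≥1 _) =
  inj₂ (inj₂ (subst Form (sym (complement₂ 𝟏 j 𝟎 k)) (form-b j≥1 k≥1)))
Form-tail (form-c {suc (suc i)} _ j≥1 k≥1 odd-j) = inj₂ (inj₁ (form-c {suc i} (s≤s z≤n) j≥1 k≥1 odd-j))
Form-tail (form-d {1} {j} _ j≥1) =
  inj₂ (inj₂ (subst Form (cong (λ u → false ∷ true ∷ u) (sym (complement-^ 𝟏 j)))
                    (form-c {1} {1} (s≤s z≤n) (s≤s z≤n) j≥1 refl)))
Form-tail (form-d {suc (suc i)} _ j≥1) = inj₂ (inj₁ (form-d {suc i} (s≤s z≤n) j≥1))
Form-tail (form-e {1} {j} {k} {ℓ} _ j≥1 k≥1 ℓ≥1 _ odd-k _ _) =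
  inj₂ (inj₂ (subst Form (sym (complement₃ 𝟏 j 𝟎 k 𝟏 ℓ)) (form-c j≥1 k≥1 ℓ≥1 odd-k)))
Form-tail (form-e {suc (suc i)} _ j≥1 k≥1 ℓ≥1 odd-j odd-k i<k ℓ<j) =
  inj₂ (inj₁ (form-e {suc i} (s≤s z≤n) j≥1 k≥1 ℓ≥1 odd-j odd-k (<⇒≤ i<k) ℓ<j))
Form-tail (form-f₁ {1} _) = inj₂ (inj₂ (form-a {1} (s≤s z≤n)))
Form-tail (form-f₁ {suc (suc i)} _) =
  inj₂ (inj₂ (subst Form (complement-01ⁿ (suc i)) (form-f₂ {suc i} (s≤s z≤n))))
Form-tail (form-f₂ {suc i} _) = inj₂ (inj₂ (subst Form (complement-01ⁿ0 i) (form-f₁ {suc i} (s≤s z≤n))))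

-- Letter counts.

# : Bool → BinaryWord → ℕ
# c w = length (filter (c ≟_) w)

#-++ : ∀ c u v → # c (u ++ v) ≡ # c u + # c v
#-++ c u v = trans (cong length (filter-++ (c ≟_) u v)) (length-++ (filter (c ≟_) u))

#-same : ∀ c n → # c ([ c ] ^ n) ≡ n
#-same c     zero    = refl
#-same false (suc n) = cong suc (#-same false n)
#-same true  (suc n) = cong suc (#-same true n)

#-other : ∀ c n → # (not c) ([ c ] ^ n) ≡ 0
#-other c     zero    = refl
#-other false (suc n) = #-other false n
#-other true  (suc n) = #-other true n

#-complement : ∀ c w → # c (complement w) ≡ # (not c) w
#-complement c     []          = refl
#-complement false (false ∷ w) = #-complement false w
#-complement false (true ∷ w)  = cong suc (#-complement false w)
#-complement true  (false ∷ w) = cong suc (#-complement true w)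
#-complement true  (true ∷ w)  = #-complement true w

#-middle : ∀ c u v s → # c v ≤ # c (u ++ v ++ s)
#-middle c u v s = begin
  # c v                    ≤⟨ m≤m+n _ _ ⟩
  # c v + # c s            ≡⟨ #-++ c v s ⟨
  # c (v ++ s)             ≤⟨ m≤n+m _ _ ⟩
  # c u + # c (v ++ s)     ≡⟨ #-++ c u (v ++ s) ⟨
  # c (u ++ v ++ s)        ∎
  where open ≤-Reasoning

-- This is abelian equivalence, the only consequence of conjugacy that the converse direction needs.
SameCounts : BinaryWord → BinaryWord → Set
SameCounts x x′ = ∀ c → # c x ≡ # c x′

Conjugate⇒SameCounts : Conjugate x x′ → SameCounts x x′
Conjugate⇒SameCounts (u , v , refl , refl) c =
  trans (#-++ c u v) (trans (+-comm (# c u) (# c v)) (sym (#-++ c v u)))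

SameCounts-complement : SameCounts x x′ → SameCounts (complement x) (complement x′)
SameCounts-complement {x} {x′} same c =
  trans (#-complement c x) (trans (same (not c)) (sym (#-complement c x′)))

SameCounts-tail : ∀ c → SameCounts (c ∷ x) (c ∷ x′) → SameCounts x x′
SameCounts-tail false same false = suc-injective (same false)
SameCounts-tail false same true  = same true
SameCounts-tail true  same false = same false
SameCounts-tail true  same true  = suc-injective (same true)

only-letter : ∀ c w → # (not c) w ≡ 0 → w ≡ [ c ] ^ # c w
only-letter c     []          _  = refl
only-letter false (false ∷ w) eq = cong (false ∷_) (only-letter false w eq)
only-letter true  (true ∷ w)  eq = cong (true ∷_) (only-letter true w eq)

power-unique : ∀ c n → SameCounts ([ c ] ^ n) x′ → [ c ] ^ n ≡ x′
power-unique {x′} c n same = begin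
  [ c ] ^ n               ≡⟨ cong ([ c ] ^_) (#-same c n) ⟨
  [ c ] ^ # c ([ c ] ^ n) ≡⟨ cong ([ c ] ^_) (same c) ⟩
  [ c ] ^ # c x′          ≡⟨ only-letter c x′ (trans (sym (same (not c))) (#-other c n)) ⟨
  x′                      ∎
  where open ≡-Reasoning

-- Adjacent factors with equal counts in words of few blocks.

-- The end of `x` falls inside the leading block or beyond it; an end exactly at the block's end is
-- given by the second case with `x₁` empty.
split : ∀ c n x {r t : BinaryWord} → x ++ r ≡ [ c ] ^ n ++ t →
  (∃₂ λ p q → p + q ≡ n × x ≡ [ c ] ^ p × r ≡ [ c ] ^ q ++ t) ⊎
  (∃ λ x₁ → x ≡ [ c ] ^ n ++ x₁ × x₁ ++ r ≡ t)
split c zero    x       eq = inj₂ (x , refl , eq)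
split c (suc n) []      eq = inj₁ (0 , suc n , refl , refl , eq)
split c (suc n) (d ∷ x) eq with refl , eq′ ← ∷-injective eq with split c n x eq′
... | inj₁ (p , q , p+q≡n , refl , r≡) = inj₁ (suc p , q , cong suc p+q≡n , refl , r≡)
... | inj₂ (x₁ , refl , eq₁)           = inj₂ (x₁ , refl , eq₁)

suc≡⇒≢0 : suc m ≡ n → n ≢ 0
suc≡⇒≢0 refl ()

power-suffix-loses : ∀ j u x′ s → u ++ x′ ++ s ≡ 𝟏 ^ j → # false x′ ≡ 0
power-suffix-loses j u x′ s eq = n≤0⇒n≡0 (begin
  # false x′               ≤⟨ #-middle false u x′ s ⟩
  # false (u ++ x′ ++ s)   ≡⟨ cong (# false) eq ⟩
  # false (𝟏 ^ j)          ≡⟨ #-other true j ⟩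
  0                        ∎)
  where open ≤-Reasoning

-- If `x` exhausts the zeros, then `x′` has none, although `x` has some.
balanced-0ⁱ1ʲ : ∀ i j x x′ s → x ++ x′ ++ s ≡ 𝟎 ^ suc i ++ 𝟏 ^ j → SameCounts x x′ → x ≡ x′
balanced-0ⁱ1ʲ i j x x′ s eq same with split false (suc i) x eq
... | inj₁ (p , _ , _ , refl , _) = power-unique false p same
... | inj₂ (u , refl , eq₁) = contradiction (power-suffix-loses j u x′ s eq₁) (suc≡⇒≢0 (same false))

-- This covers (c), as ℓ = 0, together with (e). Unless `x` consists of zeros, each position of its
-- end contradicts the counts.
balanced-0ⁱ1ʲ0ᵏ1ˡ : ∀ i j k ℓ x x′ s → Odd j → ℓ < j → ℓ ≡ 0 ⊎ suc i < k →
  x ++ x′ ++ s ≡ 𝟎 ^ suc i ++ 𝟏 ^ j ++ 𝟎 ^ k ++ 𝟏 ^ ℓ → SameCounts x x′ → x ≡ x′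
balanced-0ⁱ1ʲ0ᵏ1ˡ i j k ℓ x x′ s odd-j ℓ<j ℓ≡0⊎i<k eq same with split false (suc i) x eq
... | inj₁ (p , _ , _ , refl , _) = power-unique false p same
... | inj₂ (u , refl , eq₁) with split true j u eq₁
-- If `x` contains all of 1ʲ, at most ℓ < j ones remain for `x′`.
...   | inj₂ (v , refl , eq₂) = contradiction ℓ<j (≤⇒≯ (begin
  j                                        ≡⟨ #-same true j ⟨
  # true (𝟏 ^ j)                           ≤⟨ #-middle true (𝟎 ^ suc i) (𝟏 ^ j) v ⟩
  # true (𝟎 ^ suc i ++ 𝟏 ^ j ++ v)         ≡⟨ same true ⟩
  # true x′                                ≤⟨ #-middle true v x′ s ⟩
  # true (v ++ x′ ++ s)                    ≡⟨ cong (# true) eq₂ ⟩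
  # true (𝟎 ^ k ++ 𝟏 ^ ℓ)                  ≡⟨ #-++ true (𝟎 ^ k) (𝟏 ^ ℓ) ⟩
  # true (𝟎 ^ k) + # true (𝟏 ^ ℓ)          ≡⟨ cong₂ _+_ (#-other false k) (#-same true ℓ) ⟩
  ℓ                                        ∎))
  where open ≤-Reasoning
-- The cut divides 1ʲ into 1ᵖ and 1^q; for lack of zeros `x′` cannot end within 1^q.
...   | inj₁ (p , q , p+q≡j , refl , eq₂) with split true q x′ eq₂
...     | inj₁ (r , _ , _ , refl , _) = contradiction (#-other true r) (suc≡⇒≢0 (same false))
...     | inj₂ (v , refl , eq₃) = ⊥-elim (absurd ℓ≡0⊎i<k (split false k v eq₃))
  where
  open ≡-Reasoning
  p≡q+ones : p ≡ q + # true v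
  p≡q+ones = begin
    p                                       ≡⟨ #-same true p ⟨
    # true (𝟏 ^ p)                          ≡⟨ cong (_+ # true (𝟏 ^ p)) (#-other false (suc i)) ⟨
    # true (𝟎 ^ suc i) + # true (𝟏 ^ p)     ≡⟨ #-++ true (𝟎 ^ suc i) (𝟏 ^ p) ⟨
    # true (𝟎 ^ suc i ++ 𝟏 ^ p)             ≡⟨ same true ⟩
    # true (𝟏 ^ q ++ v)                     ≡⟨ #-++ true (𝟏 ^ q) v ⟩
    # true (𝟏 ^ q) + # true v               ≡⟨ cong (_+ # true v) (#-same true q) ⟩
    q + # true v                            ∎
  zeros : suc i ≡ # false v
  zeros = begin
    suc i                                   ≡⟨ #-same false (suc i) ⟨
    # false (𝟎 ^ suc i)                     ≡⟨ +-identityʳ _ ⟨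
    # false (𝟎 ^ suc i) + 0                 ≡⟨ cong (# false (𝟎 ^ suc i) +_) (#-other true p) ⟨
    # false (𝟎 ^ suc i) + # false (𝟏 ^ p)   ≡⟨ #-++ false (𝟎 ^ suc i) (𝟏 ^ p) ⟨
    # false (𝟎 ^ suc i ++ 𝟏 ^ p)            ≡⟨ same false ⟩
    # false (𝟏 ^ q ++ v)                    ≡⟨ #-++ false (𝟏 ^ q) v ⟩
    # false (𝟏 ^ q) + # false v             ≡⟨ cong (_+ # false v) (#-other true q) ⟩
    # false v                               ∎
  -- If `v` had no ones, then p = q and j = 2q would be even.
  no-more-ones : ∀ r → v ≢ 𝟎 ^ r
  no-more-ones r refl = parity-m+m q (subst Odd (trans (sym p+q≡j) (cong (_+ q) p≡q)) odd-j)
    where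
    p≡q : p ≡ q
    p≡q = trans p≡q+ones (trans (cong (q +_) (#-other false r)) (+-identityʳ q))
  absurd : ℓ ≡ 0 ⊎ suc i < k →
           (∃₂ λ r r′ → r + r′ ≡ k × v ≡ 𝟎 ^ r × s ≡ 𝟎 ^ r′ ++ 𝟏 ^ ℓ) ⊎
           (∃ λ v₁ → v ≡ 𝟎 ^ k ++ v₁ × v₁ ++ s ≡ 𝟏 ^ ℓ) → ⊥
  absurd _ (inj₁ (r , _ , _ , v≡ , _)) = no-more-ones r v≡
  absurd (inj₁ refl) (inj₂ (v₁ , v≡ , eq₄)) = no-more-ones k
    (trans v≡ (trans (cong (𝟎 ^ k ++_) (++-conicalˡ v₁ s eq₄)) (++-identityʳ _)))
  -- Here `v` contains all k zeros of the third block, but only i+1 < k zeros are allowed.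
  absurd (inj₂ i<k) (inj₂ (v₁ , v≡ , _)) = <⇒≱ i<k
    (subst₂ _≤_ (#-same false k) (trans (cong (# false) (sym v≡)) (sym zeros))
      (#-middle false [] (𝟎 ^ k) v₁))

balanced-0ⁱ101ʲ : ∀ i j x x′ s → x ++ x′ ++ s ≡ 𝟎 ^ suc i ++ 𝟏 ++ 𝟎 ++ 𝟏 ^ j → SameCounts x x′ → x ≡ x′
balanced-0ⁱ101ʲ i j x x′ s eq same with split false (suc i) x eq
... | inj₁ (p , _ , _ , refl , _) = power-unique false p same
... | inj₂ ([] , refl , _) = subst (_≡ x′) (sym (++-identityʳ (𝟎 ^ suc i)))
  (power-unique false (suc i) (subst (λ u → SameCounts u x′) (++-identityʳ (𝟎 ^ suc i)) same))
... | inj₂ (true ∷ false ∷ u , refl , eq₁) =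
  contradiction (power-suffix-loses j u x′ s (proj₂ (∷-injective (proj₂ (∷-injective eq₁))))) (suc≡⇒≢0 (same false))
-- Now `x′` is a prefix of 0 1ʲ, so it has at most one zero; hence `i` is 0 and both words are 01.
... | inj₂ (true ∷ [] , refl , eq₁) = midpoint-after-0ⁱ1 i x′ (proj₂ (∷-injective eq₁)) same
  where
  midpoint-after-0ⁱ1 : ∀ i x′ → x′ ++ s ≡ 𝟎 ++ 𝟏 ^ j → SameCounts (𝟎 ^ suc i ++ 𝟏) x′ → 𝟎 ^ suc i ++ 𝟏 ≡ x′
  midpoint-after-0ⁱ1 i [] _ same = contradiction refl (suc≡⇒≢0 (same false))
  midpoint-after-0ⁱ1 i (false ∷ v) eq same
    with none ← power-suffix-loses j [] v s (proj₂ (∷-injective eq)) | i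
  ... | zero  = cong (false ∷_) (trans (cong (𝟏 ^_) (same true)) (sym (only-letter true v none)))
  ... | suc _ = contradiction none (suc≡⇒≢0 (suc-injective (same false)))

-- Alternating words.

data Alternating : Bool → BinaryWord → Set where
  []   : Alternating c []
  cons : Alternating (not c) w → Alternating c (c ∷ w)

Alternating-01ⁿ : ∀ n → Alternating false w → Alternating false ((𝟎 ++ 𝟏) ^ n ++ w)
Alternating-01ⁿ zero    alt = alt
Alternating-01ⁿ (suc n) alt = cons (cons (Alternating-01ⁿ n alt))

-- The excess of `c` over the other letter in `x` is 0 or 1 according to the parity of its length,
-- which also fixes the letter at which the rest resumes.
Alternating-split : ∀ x → Alternating c (x ++ w) →
  Alternating c x × (# c x ≡ # (not c) x × Alternating c w ⊎
                     # c x ≡ suc (# (not c) x) × Alternating (not c) w)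
Alternating-split []      alt = [] , inj₁ (refl , alt)
Alternating-split (false ∷ x) (cons alt) with Alternating-split x alt
... | alt-x , inj₁ (eq , alt-w) = cons alt-x , inj₂ (cong suc (sym eq) , alt-w)
... | alt-x , inj₂ (eq , alt-w) = cons alt-x , inj₁ (sym eq , alt-w)
Alternating-split (true ∷ x) (cons alt) with Alternating-split x alt
... | alt-x , inj₁ (eq , alt-w) = cons alt-x , inj₂ (cong suc (sym eq) , alt-w)
... | alt-x , inj₂ (eq , alt-w) = cons alt-x , inj₁ (sym eq , alt-w)

Alternating-unique : Alternating c x → Alternating c x′ → SameCounts x x′ → x ≡ x′
Alternating-unique []           []           _    = refl
Alternating-unique {false} []   (cons _)     same with () ← same false
Alternating-unique {true}  []   (cons _)     same with () ← same true
Alternating-unique {false} (cons _) []       same with () ← same false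
Alternating-unique {true}  (cons _) []       same with () ← same true
Alternating-unique {c} (cons alt) (cons alt′) same =
  cong (c ∷_) (Alternating-unique alt alt′ (SameCounts-tail c same))

balanced-alternating : ∀ x x′ s → Alternating false (x ++ x′ ++ s) → SameCounts x x′ → x ≡ x′
balanced-alternating x x′ s alt same with Alternating-split x alt
... | alt-x , inj₁ (_ , alt-r) = Alternating-unique alt-x (proj₁ (Alternating-split x′ alt-r)) same
-- For odd length `x` has one more 0 than 1, whereas `x′` starts at 1 and has at least as many ones
-- as zeros. The offsets 0 and 1 below are the excess of ones in `x′`.
... | _     , inj₂ (eq , alt-r) with Alternating-split x′ alt-r
...   | _ , inj₁ (eq′ , _) =
  contradiction (trans (sym (same false)) (trans eq (cong suc (trans (same true) eq′)))) (m≢1+n+m _ {0})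
...   | _ , inj₂ (eq′ , _) =
  contradiction (trans (sym (same false)) (trans eq (cong suc (trans (same true) eq′)))) (m≢1+n+m _ {1})

-- Forms are mesosome-free.

-- Forms (a) and (c) are padded with an empty last block of ones to fit the block lemmas.
balanced-Form : ∀ x x′ s → Form w → x ++ x′ ++ s ≡ w → SameCounts x x′ → x ≡ x′
balanced-Form x x′ s (form-a {suc i} _) eq =
  balanced-0ⁱ1ʲ i 0 x x′ s (trans eq (sym (++-identityʳ _)))
balanced-Form x x′ s (form-b {suc i} {j} _ _) eq = balanced-0ⁱ1ʲ i j x x′ s eq
balanced-Form x x′ s (form-c {suc i} {j} {k} _ j≥1 _ odd-j) eq =
  balanced-0ⁱ1ʲ0ᵏ1ˡ i j k 0 x x′ s odd-j j≥1 (inj₁ refl)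
    (trans eq (cong (λ u → 𝟎 ^ suc i ++ 𝟏 ^ j ++ u) (sym (++-identityʳ _))))
balanced-Form x x′ s (form-d {suc i} {j} _ _) eq = balanced-0ⁱ101ʲ i j x x′ s eq
balanced-Form x x′ s (form-e {suc i} {j} {k} {ℓ} _ _ _ _ odd-j _ i<k ℓ<j) eq =
  balanced-0ⁱ1ʲ0ᵏ1ˡ i j k ℓ x x′ s odd-j ℓ<j (inj₂ i<k) eq
balanced-Form x x′ s (form-f₁ {i} _) eq =
  balanced-alternating x x′ s (subst (Alternating false) (trans (++-identityʳ _) (sym eq)) (Alternating-01ⁿ i []))
balanced-Form x x′ s (form-f₂ {i} _) eq =
  balanced-alternating x x′ s (subst (Alternating false) (sym eq) (Alternating-01ⁿ i (cons [])))

balanced-Good : ∀ x x′ s → Good (x ++ x′ ++ s) → SameCounts x x′ → x ≡ x′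
balanced-Good x x′ s (inj₁ F) same = balanced-Form x x′ s F refl same
balanced-Good x x′ s (inj₂ F) same = map-injective not-injective
  (balanced-Form (complement x) (complement x′) (complement s) F
    (sym (trans (map-++ not x _) (cong (complement x ++_) (map-++ not x′ s))))
    (SameCounts-complement {x} {x′} same))

Good-tail : Good (c ∷ w) → w ≡ [] ⊎ Good w
Good-tail (inj₁ F) = Form-tail F
Good-tail {w = w} (inj₂ F) with Form-tail F
... | inj₁ eq = inj₁ (trans (sym (complement-involutive w)) (cong complement eq))
... | inj₂ G  = inj₂ (subst Good (complement-involutive w) (Good-complement G))

prefix-remainder : Prefix _≡_ x w → ∃ λ s → w ≡ x ++ s
prefix-remainder p with x≋ Prefix.++ s ← Prefix.toView p = s , cong (_++ s) (sym (Pointwise-≡⇒≡ x≋))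

Good⇒MesosomeFree : ∀ w → w ≡ [] ⊎ Good w → MesosomeFree w
Good⇒MesosomeFree [] _ (here Prefix.[]) (f≢[] , _) = f≢[] refl
Good⇒MesosomeFree (_ ∷ _) (inj₂ G) (here p) (_ , x , x′ , refl , conj , x≢x′)
  with s , eq ← prefix-remainder p =
  x≢x′ (balanced-Good x x′ s (subst Good (trans eq (++-assoc x x′ s)) G) (Conjugate⇒SameCounts conj))
Good⇒MesosomeFree (_ ∷ w) (inj₂ G) (there f∈w) = Good⇒MesosomeFree w (Good-tail G) f∈w

theorem1 : ∀ (x : BinaryWord) → x ≢ [] → MesosomeFree x ⇔ (Form x ⊎ Form (complement x))
theorem1 x x≢[] = mk⇔ (classify x x≢[]) (λ G → Good⇒MesosomeFree x (inj₂ G))
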